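{- Let $S$ be a finite nonempty set of points in the integer lattice $\mathbb{Z}\times\mathbb{Z}\subset\mathbb{E}^2$. Then for every finite coloring of the plane $\mathbb{E}^2$, there exist uncountably many monochromatic subsets of $\mathbb{E}^2$ that are homothetic to $S$.
   Context: $\mathbb{E}^2$ denotes the Euclidean plane, identified with $\mathbb{R}^2$. A finite coloring of $\mathbb{E}^2$ is a map $\chi:\mathbb{E}^2\to\{1,\ldots,k\}$ for some positive integer $k$; a subset of $\mathbb{E}^2$ is monochromatic if $\chi$ is constant on it. A set $A\subset\mathbb{E}^2$ is homothetic to a set $B\subset\mathbb{E}^2$ if $A$ can be mapped onto $B$ by a translation and a dilation (scaling by a positive real factor), i.e. $B=v+\lambda A$ for some $v\in\mathbb{R}^2$ and some real $\lambda>0$. -}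

module Defs where

open import Data.Fin using (Fin)
open import Data.Integer using (ℤ)
open import Data.List using (List)
import Data.List.Membership.Propositional as List
open import Data.Maybe.Relation.Binary.Pointwise as Maybe using ()
open import Data.Nat as ℕ using (ℕ)
import Data.Nat.Properties as ℕ
open import Data.Product using (Σ; ∃; _×_; _,_; proj₁; proj₂)
open import Data.Product.Relation.Binary.Pointwise.NonDependent using (×-setoid)
open import Data.Rational as ℚ using (ℚ; 0ℚ; 1ℚ; ½; ∣_∣)
import Data.Rational.Properties as ℚ
open import Data.Rational.Solver using (module +-*-Solver)
open import Function.Bundles using (Func; Surjection)
open import Level using (0ℓ; suc)
open import Relation.Binary.Bundles using (Setoid)
import Relation.Binary.Construct.On as On
open import Relation.Binary.Definitions using (_Respects_)
open import Relation.Binary.PropositionalEquality as ≡ using (_≡_; refl; sym; cong; subst)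
open import Relation.Nullary using (¬_)
open import Relation.Unary using (Pred; _≐_)

private
  half : ℚ → ℚ
  half ε = ε ℚ.* ½

  half-pos : ∀ {ε} → 0ℚ ℚ.< ε → 0ℚ ℚ.< half ε
  half-pos {ε} ε>0 = ℚ.positive⁻¹ (half ε) {{ℚ.pos*pos⇒pos ε {{ℚ.positive ε>0}} ½}}

  half+half : ∀ ε → half ε ℚ.+ half ε ≡ ε
  half+half ε = ≡.trans (sym (ℚ.*-distribˡ-+ ε ½ ½)) (ℚ.*-identityʳ ε)

  +-close : ∀ {a b ε} → ∣ a ∣ ℚ.< half ε → ∣ b ∣ ℚ.< half ε → ∣ a ℚ.+ b ∣ ℚ.< ε
  +-close {a} {b} {ε} p q = begin-strict
    ∣ a ℚ.+ b ∣       ≤⟨ ℚ.∣p+q∣≤∣p∣+∣q∣ a b ⟩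
    ∣ a ∣ ℚ.+ ∣ b ∣   <⟨ ℚ.+-mono-< p q ⟩
    half ε ℚ.+ half ε ≡⟨ half+half ε ⟩
    ε                 ∎
    where open ℚ.≤-Reasoning

  ∣-∣-swap : ∀ a b → ∣ a ℚ.- b ∣ ≡ ∣ b ℚ.- a ∣
  ∣-∣-swap a b = ≡.trans (cong ∣_∣ (eq a b)) (ℚ.∣-p∣≡∣p∣ (b ℚ.- a))
    where
    open +-*-Solver
    eq : ∀ a b → a ℚ.- b ≡ ℚ.- (b ℚ.- a)
    eq = solve 2 (λ a b → a :- b := :- (b :- a)) refl

  +-swap : ∀ a b c d → (a ℚ.+ b) ℚ.- (c ℚ.+ d) ≡ (a ℚ.- c) ℚ.+ (b ℚ.- d)
  +-swap = solve 4 (λ a b c d → (a :+ b) :- (c :+ d) := (a :- c) :+ (b :- d)) refl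
    where open +-*-Solver

  *-swap : ∀ a b c d → a ℚ.* b ℚ.- c ℚ.* d ≡ a ℚ.* (b ℚ.- d) ℚ.+ d ℚ.* (a ℚ.- c)
  *-swap = solve 4 (λ a b c d → a :* b :- c :* d := a :* (b :- d) :+ d :* (a :- c)) refl
    where open +-*-Solver

  *-left-swap : ∀ a b c → a ℚ.* (b ℚ.* c) ≡ b ℚ.* (a ℚ.* c)
  *-left-swap = solve 3 (λ a b c → a :* (b :* c) := b :* (a :* c)) refl
    where open +-*-Solver

  sub-add : ∀ a b → a ≡ (a ℚ.- b) ℚ.+ b
  sub-add = solve 2 (λ a b → a := (a :- b) :+ b) refl
    where open +-*-Solver

  telescope : ∀ a b c → a ℚ.- c ≡ (a ℚ.- b) ℚ.+ (b ℚ.- c)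
  telescope = solve 3 (λ a b c → a :- c := (a :- b) :+ (b :- c)) refl
    where open +-*-Solver

IsCauchy : (ℕ → ℚ) → Set
IsCauchy x = ∀ ε → 0ℚ ℚ.< ε →
  ∃ λ N → ∀ m n → N ℕ.≤ m → N ℕ.≤ n → ∣ x m ℚ.- x n ∣ ℚ.< ε

-- The quotient of Cauchy sequences by `_≈_` is not formed: colorings and
-- subsets of the plane are instead required to respect `_≈_`.
record ℝ : Set where
  constructor mkℝ
  field
    seq    : ℕ → ℚ
    cauchy : IsCauchy seq

open ℝ public

infix 4 _≈_
record _≈_ (x y : ℝ) : Set where
  constructor mk≈
  field
    close : ∀ ε → 0ℚ ℚ.< ε →
      ∃ λ N → ∀ n → N ℕ.≤ n → ∣ seq x n ℚ.- seq y n ∣ ℚ.< ε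

open _≈_ public

≈-refl : ∀ {x} → x ≈ x
≈-refl {x} .close ε ε>0 =
  0 , λ n _ → subst (ℚ._< ε) (cong ∣_∣ (sym (ℚ.+-inverseʳ (seq x n)))) ε>0

≈-sym : ∀ {x y} → x ≈ y → y ≈ x
≈-sym {x} {y} x≈y .close ε ε>0 =
  let N , h = close x≈y ε ε>0
  in N , λ n N≤n → subst (ℚ._< ε) (∣-∣-swap (seq x n) (seq y n)) (h n N≤n)

≈-trans : ∀ {x y z} → x ≈ y → y ≈ z → x ≈ z
≈-trans {x} {y} {z} x≈y y≈z .close ε ε>0 =
  let M , g = close x≈y (half ε) (half-pos ε>0)
      N , h = close y≈z (half ε) (half-pos ε>0)
  in M ℕ.⊔ N , λ n MN≤n →
    subst (ℚ._< ε) (cong ∣_∣ (sym (telescope (seq x n) (seq y n) (seq z n))))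
      (+-close {seq x n ℚ.- seq y n} {seq y n ℚ.- seq z n}
        (g n (ℕ.m⊔n≤o⇒m≤o M N MN≤n)) (h n (ℕ.m⊔n≤o⇒n≤o M N MN≤n)))

ℝ-setoid : Setoid 0ℓ 0ℓ
ℝ-setoid = record
  { Carrier = ℝ
  ; _≈_     = _≈_
  ; isEquivalence = record { refl = ≈-refl ; sym = ≈-sym ; trans = ≈-trans }
  }

-- The sequence must stay eventually above a positive rational: positivity of
-- the terms alone would allow the limit 0.
Positive : ℝ → Set
Positive x = ∃ λ ε → 0ℚ ℚ.< ε × ∃ λ N → ∀ n → N ℕ.≤ n → ε ℚ.< seq x n

fromℤ : ℤ → ℝ
fromℤ z = mkℝ (λ _ → q) λ ε ε>0 →
  0 , λ _ _ _ _ → subst (ℚ._< ε) (cong ∣_∣ (sym (ℚ.+-inverseʳ q))) ε>0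
  where
  q : ℚ
  q = z ℚ./ 1

infixl 6 _+_
_+_ : ℝ → ℝ → ℝ
mkℝ x cx + mkℝ y cy = mkℝ (λ n → x n ℚ.+ y n) c
  where
  c : IsCauchy (λ n → x n ℚ.+ y n)
  c ε ε>0 with cx (half ε) (half-pos ε>0) | cy (half ε) (half-pos ε>0)
  ... | M , g | N , h = M ℕ.⊔ N , λ m n MN≤m MN≤n →
    subst (ℚ._< ε) (cong ∣_∣ (sym (+-swap (x m) (y m) (x n) (y n))))
      (+-close {x m ℚ.- x n} {y m ℚ.- y n}
        (g m n (ℕ.m⊔n≤o⇒m≤o M N MN≤m) (ℕ.m⊔n≤o⇒m≤o M N MN≤n))
        (h m n (ℕ.m⊔n≤o⇒n≤o M N MN≤m) (ℕ.m⊔n≤o⇒n≤o M N MN≤n)))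

private
  EventuallyBounded : (ℕ → ℚ) → Set
  EventuallyBounded x =
    ∃ λ B → ℚ.Positive B × ∃ λ N → ∀ n → N ℕ.≤ n → ∣ x n ∣ ℚ.≤ B

  cauchy⇒bounded : ∀ x → IsCauchy x → EventuallyBounded x
  cauchy⇒bounded x cx with cx 1ℚ (ℚ.positive⁻¹ 1ℚ)
  ... | N , h =
    1ℚ ℚ.+ ∣ x N ∣ ,
    ℚ.pos+nonNeg⇒pos 1ℚ ∣ x N ∣ {{ℚ.∣-∣-nonNeg (x N)}} ,
    N , λ n N≤n → begin
      ∣ x n ∣                      ≡⟨ cong ∣_∣ (sub-add (x n) (x N)) ⟩
      ∣ (x n ℚ.- x N) ℚ.+ x N ∣    ≤⟨ ℚ.∣p+q∣≤∣p∣+∣q∣ (x n ℚ.- x N) (x N) ⟩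
      ∣ x n ℚ.- x N ∣ ℚ.+ ∣ x N ∣  ≤⟨ ℚ.+-monoˡ-≤ ∣ x N ∣ (ℚ.<⇒≤ (h n N N≤n ℕ.≤-refl)) ⟩
      1ℚ ℚ.+ ∣ x N ∣               ∎
    where
    open ℚ.≤-Reasoning

  *-small : ∀ {ε} → 0ℚ ℚ.< ε → ∀ {B} → ℚ.Positive B →
    ∃ λ δ → 0ℚ ℚ.< δ × (∀ a d → ∣ a ∣ ℚ.≤ B → ∣ d ∣ ℚ.< δ → ∣ a ℚ.* d ∣ ℚ.< ε)
  *-small {ε} ε>0 {B} B>0 = δ , ℚ.positive⁻¹ δ {{δ>0}} , bound
    where
    instance
      _ = B>0
      _ = ℚ.pos⇒nonZero B
      _ = ℚ.positive ε>0
    δ : ℚ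
    δ = ε ℚ.* ℚ.1/ B
    δ>0 : ℚ.Positive δ
    δ>0 = ℚ.pos*pos⇒pos ε (ℚ.1/ B) {{ℚ.1/pos⇒pos B}}
    open ℚ.≤-Reasoning
    bound : ∀ a d → ∣ a ∣ ℚ.≤ B → ∣ d ∣ ℚ.< δ → ∣ a ℚ.* d ∣ ℚ.< ε
    bound a d ∣a∣≤B ∣d∣<δ = begin-strict
      ∣ a ℚ.* d ∣          ≡⟨ ℚ.∣p*q∣≡∣p∣*∣q∣ a d ⟩
      ∣ a ∣ ℚ.* ∣ d ∣      ≤⟨ ℚ.*-monoʳ-≤-nonNeg ∣ d ∣ {{ℚ.∣-∣-nonNeg d}} ∣a∣≤B ⟩
      B ℚ.* ∣ d ∣          <⟨ ℚ.*-monoʳ-<-pos B ∣d∣<δ ⟩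
      B ℚ.* (ε ℚ.* ℚ.1/ B) ≡⟨ *-left-swap B ε (ℚ.1/ B) ⟩
      ε ℚ.* (B ℚ.* ℚ.1/ B) ≡⟨ cong (ε ℚ.*_) (ℚ.*-inverseʳ B) ⟩
      ε ℚ.* 1ℚ             ≡⟨ ℚ.*-identityʳ ε ⟩
      ε                    ∎

infixl 7 _*_
_*_ : ℝ → ℝ → ℝ
mkℝ x cx * mkℝ y cy = mkℝ (λ n → x n ℚ.* y n) c
  where
  c : IsCauchy (λ n → x n ℚ.* y n)
  c ε ε>0 =
    let B , B>0 , K , bx = cauchy⇒bounded x cx
        C , C>0 , L , by = cauchy⇒bounded y cy
        δ , δ>0 , sx = *-small (half-pos ε>0) B>0
        η , η>0 , sy = *-small (half-pos ε>0) C>0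
        M , g = cy δ δ>0
        N , h = cx η η>0
    in K ℕ.⊔ L ℕ.⊔ (M ℕ.⊔ N) , λ m n ≤m ≤n →
    let KL≤m = ℕ.m⊔n≤o⇒m≤o (K ℕ.⊔ L) (M ℕ.⊔ N) ≤m
        KL≤n = ℕ.m⊔n≤o⇒m≤o (K ℕ.⊔ L) (M ℕ.⊔ N) ≤n
        MN≤m = ℕ.m⊔n≤o⇒n≤o (K ℕ.⊔ L) (M ℕ.⊔ N) ≤m
        MN≤n = ℕ.m⊔n≤o⇒n≤o (K ℕ.⊔ L) (M ℕ.⊔ N) ≤n
    in subst (ℚ._< ε) (cong ∣_∣ (sym (*-swap (x m) (y m) (x n) (y n))))
      (+-close {x m ℚ.* (y m ℚ.- y n)} {y n ℚ.* (x m ℚ.- x n)}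
        (sx (x m) (y m ℚ.- y n) (bx m (ℕ.m⊔n≤o⇒m≤o K L KL≤m))
          (g m n (ℕ.m⊔n≤o⇒m≤o M N MN≤m) (ℕ.m⊔n≤o⇒m≤o M N MN≤n)))
        (sy (y n) (x m ℚ.- x n) (by n (ℕ.m⊔n≤o⇒n≤o K L KL≤n))
          (h m n (ℕ.m⊔n≤o⇒n≤o M N MN≤m) (ℕ.m⊔n≤o⇒n≤o M N MN≤n))))

𝔼²-setoid : Setoid 0ℓ 0ℓ
𝔼²-setoid = ×-setoid ℝ-setoid ℝ-setoid

module 𝔼² = Setoid 𝔼²-setoid

𝔼² : Set
𝔼² = 𝔼².Carrier

infixl 6 _+ᵥ_
_+ᵥ_ : 𝔼² → 𝔼² → 𝔼²
(x , y) +ᵥ (x′ , y′) = x + x′ , y + y′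

infixr 7 _·_
_·_ : ℝ → 𝔼² → 𝔼²
r · (x , y) = r * x , r * y

record Subset : Set₁ where
  field
    points   : Pred 𝔼² 0ℓ
    respects : points Respects 𝔼²._≈_

open Subset public

infix 4 _∈_
_∈_ : 𝔼² → Subset → Set
p ∈ A = points A p

Subset-setoid : Setoid (suc 0ℓ) 0ℓ
Subset-setoid = record
  { Carrier = Subset
  ; _≈_     = λ A B → points A ≐ points B
  ; isEquivalence = record
    { refl  = (λ p → p) , (λ p → p)
    ; sym   = λ (f , g) → g , f
    ; trans = λ (f , g) (f′ , g′) → (λ p → f′ (f p)) , (λ p → g (g′ p))
    }
  }

open Setoid Subset-setoid public using () renaming (_≈_ to _≈ₛ_)

image : {I : Set} → (I → 𝔼²) → Pred I 0ℓ → Subset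
image f P = record
  { points   = λ p → ∃ λ i → P i × p 𝔼².≈ f i
  ; respects = λ { p≈q (i , Pi , p≈fi) → i , Pi , 𝔼².trans (𝔼².sym p≈q) p≈fi }
  }

-- The factor multiplies A: B = v + r A.
Homothetic : Subset → Subset → Set
Homothetic A B =
  ∃ λ v → ∃ λ r → Positive r × B ≈ₛ image (λ a → v +ᵥ r · a) (points A)

lattice : Pred (ℤ × ℤ) 0ℓ → Subset
lattice = image λ (a , b) → fromℤ a , fromℤ b

Finite : {A : Set} → Pred A 0ℓ → Set
Finite {A} P = ∃ λ (xs : List A) → P ≐ (List._∈ xs)

Coloring : ℕ → Set
Coloring k = Func 𝔼²-setoid (≡.setoid (Fin k))

Monochromatic : ∀ {k} → Coloring k → Subset → Set
Monochromatic χ A = ∀ p q → p ∈ A → q ∈ A → Func.to χ p ≡ Func.to χ q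

-- `nothing` makes room for empty and finite setoids, so that this says
-- "at most countable".
Countable : ∀ {c ℓ} → Setoid c ℓ → Set _
Countable X = Surjection (≡.setoid ℕ) (Maybe.setoid X)

-- Members are counted up to equality of subsets only: neither the proof
-- of membership nor the choice of homothety is taken into account.
family : Pred Subset 0ℓ → Setoid (suc 0ℓ) 0ℓ
family 𝒞 = On.setoid {B = Σ Subset 𝒞} Subset-setoid proj₁

UncountablyMany : Pred Subset 0ℓ → Set₁
UncountablyMany 𝒞 = ¬ Countable (family 𝒞)

{-# OPTIONS --safe #-}

-- Fix a family of sets said to enumerate the monochromatic homothetic copies,
-- and a point s₀ ∈ S.  Let aₙ be the abscissa of the point of the n-th set that
-- its homothety sends to s₀.  By Cantor's diagonal argument there is a real x
-- with x + z ≠ aₙ for all n and all integers z.  The Hales–Jewett theorem,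
-- applied to the colouring w ↦ χ ((x , 0) + w₁ + ⋯ + w_ℓ) of words with
-- letters in S, gives a monochromatic copy of S inside (x , 0) + ℤ × ℤ, which
-- differs from the n-th set because none of its points has abscissa aₙ.

module Submission where

open import Defs
open import Data.Empty using (⊥-elim)
open import Data.Fin using (Fin; zero; suc; funToFin; finToFun)
open import Data.Fin.Properties using (_≟_; any?; injective⇒≤; finToFun-funToFin)
open import Data.Integer as ℤ using (ℤ; +_; -[1+_]; _⊖_)
import Data.Integer.Properties as ℤ
import Data.Integer.Solver as ℤ
import Data.List as List
open import Data.List.Membership.Propositional.Properties using (∈-lookup)
open import Data.List.Relation.Unary.Any using (index)
open import Data.List.Relation.Unary.Any.Properties using (lookup-index; ¬Any[])
open import Data.Maybe as Maybe using (Maybe; just; nothing; fromMaybe)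
import Data.Maybe.Relation.Binary.Pointwise as Maybe
open import Data.Nat as ℕ using (ℕ; zero; suc; _^_; NonZero)
import Data.Nat.Properties as ℕ
open import Data.Product using (∃; _×_; _,_; proj₁; proj₂)
open import Data.Rational as ℚ using (ℚ; 0ℚ; 1ℚ; ½; ∣_∣)
import Data.Rational.Properties as ℚ
open import Data.Rational.Solver using (module +-*-Solver)
open import Data.Rational.Unnormalised as ℚᵘ using (mkℚᵘ; *≡*; *≤*)
import Data.Rational.Unnormalised.Properties as ℚᵘ
open import Data.Sum using (_⊎_; inj₁; inj₂)
open import Data.Unit using (tt)
open import Data.Vec using (Vec; []; _∷_; _++_; map; lookup; tabulate)
import Data.Vec.Membership.Propositional as Vec
import Data.Vec.Membership.Propositional.Properties as Vec
open import Data.Vec.Properties using (map-++; map-∘; map-id; map-cong; tabulate-cong; tabulate∘lookup)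
import Data.Vec.Relation.Unary.Any as Vec
open import Function using (_∘_)
open import Function.Bundles using (Func; Surjection)
open import Level using (0ℓ)
open import Relation.Binary.PropositionalEquality
  using (_≡_; refl; sym; trans; cong; cong₂; subst; module ≡-Reasoning)
open import Relation.Nullary using (¬_; yes; no)
open import Relation.Unary using (Pred; Satisfiable; U)

-- The Hales–Jewett theorem

Word : ℕ → ℕ → Set
Word m n = Vec (Fin m) n

-- `nothing` marks the active coordinates of a combinatorial line.
Template : ℕ → ℕ → Set
Template m n = Vec (Maybe (Fin m)) n

fill : ∀ {m n} → Template m n → Fin m → Word m n
fill t a = map (fromMaybe a) t

MonochromaticLine : ∀ {m n} {C : Set} → (Word m n → C) → Set
MonochromaticLine c = ∃ λ t → nothing Vec.∈ t × ∀ a b → c (fill t a) ≡ c (fill t b)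

-- Quantified over all `k`, since the induction on the alphabet calls the smaller case with the far
-- larger number of colours in `uniformLine`.
HalesJewett : ℕ → Set
HalesJewett m = ∀ k → ∃ λ n → (c : Word m n → Fin k) → MonochromaticLine c

fill-++ : ∀ {m n o} (t : Template m n) (t′ : Template m o) a →
  fill (t ++ t′) a ≡ fill t a ++ fill t′ a
fill-++ t t′ a = map-++ (fromMaybe a) t t′

fill-constant : ∀ {m n} (w : Word m n) a → fill (map just w) a ≡ w
fill-constant w a = trans (sym (map-∘ (fromMaybe a) just w)) (map-id w)

-- The smaller alphabet sits inside the larger one as the nonzero letters, so `zero` is the letter
-- gained in the induction step.
liftTemplate : ∀ {m n} → Template m n → Template (suc m) n
liftTemplate = map (Maybe.map suc)

fill-liftTemplate : ∀ {m n} (t : Template m n) a →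
  fill (liftTemplate t) (suc a) ≡ map suc (fill t a)
fill-liftTemplate t a = begin
  map (fromMaybe (suc a)) (map (Maybe.map suc) t) ≡⟨ map-∘ _ _ t ⟨
  map (fromMaybe (suc a) ∘ Maybe.map suc) t       ≡⟨ map-cong commute t ⟩
  map (suc ∘ fromMaybe a) t                       ≡⟨ map-∘ _ _ t ⟩
  map suc (map (fromMaybe a) t)                   ∎
  where
  open ≡-Reasoning
  commute : ∀ x → fromMaybe (suc a) (Maybe.map suc x) ≡ suc (fromMaybe a x)
  commute nothing  = refl
  commute (just _) = refl

-- Numbering the words lets a whole colouring of words be a single colour of a larger `Fin`.
encode : ∀ {m n} → Word m n → Fin (m ^ n)
encode w = funToFin (lookup w)

decode : ∀ {m n} → Fin (m ^ n) → Word m n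
decode i = tabulate (finToFun i)

decode-encode : ∀ {m n} (w : Word m n) → decode (encode w) ≡ w
decode-encode w =
  trans (tabulate-cong (finToFun-funToFin (lookup w))) (tabulate∘lookup w)

-- Each u is coloured by the whole colouring c u of the second factor.
uniformLine : ∀ {m} → HalesJewett m → ∀ l n k → ∃ λ o →
  (c : Word m o → Word l n → Fin k) →
  ∃ λ t → nothing Vec.∈ t × ∀ v a b → c (fill t a) v ≡ c (fill t b) v
uniformLine hj l n k = proj₁ line , λ c →
  let t , active , mono = proj₂ line (colouring c) in
  t , active , λ v a b → begin
    c (fill t a) v
      ≡⟨ recover c (fill t a) v ⟨
    finToFun (colouring c (fill t a)) (encode v)
      ≡⟨ cong (λ f → finToFun f (encode v)) (mono a b) ⟩
    finToFun (colouring c (fill t b)) (encode v)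
      ≡⟨ recover c (fill t b) v ⟩
    c (fill t b) v ∎
  where
  open ≡-Reasoning
  line = hj (k ^ (l ^ n))
  colouring : ∀ {A : Set} → (A → Word l n → Fin k) → A → Fin (k ^ (l ^ n))
  colouring c u = funToFin (c u ∘ decode)
  recover : ∀ {A : Set} (c : A → Word l n → Fin k) u v →
    finToFun (colouring c u) (encode v) ≡ c u v
  recover c u v = trans (finToFun-funToFin (c u ∘ decode) (encode v))
                        (cong (c u) (decode-encode v))

-- The letter zero is left out of the spokes: they meet there.
record Focused {m n k} (c : Word (suc m) n → Fin k) (r : ℕ) : Set where
  field
    focus     : Word (suc m) n
    spoke     : Fin r → Template (suc m) n
    active    : ∀ j → nothing Vec.∈ spoke j
    meets     : ∀ j → fill (spoke j) zero ≡ focus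
    colour    : Fin r → Fin k
    coloured  : ∀ j a → c (fill (spoke j) (suc a)) ≡ colour j
    injective : ∀ {i j} → colour i ≡ colour j → i ≡ j

-- A new block of coordinates carries a line independent of the old block; the
-- old spokes are run along it, and the old focus provides the new spoke unless
-- its colour repeats that of an old spoke.
focusing : ∀ {m} → HalesJewett (suc m) → ∀ k r → ∃ λ n →
  (c : Word (suc (suc m)) n → Fin k) → MonochromaticLine c ⊎ Focused c r
focusing hj k zero = 0 , λ c → inj₂ record
  { focus = [] ; spoke = λ () ; active = λ () ; meets = λ () ; colour = λ ()
  ; coloured = λ () ; injective = λ { {()} } }
focusing {m} hj k (suc r) with focusing hj k r
... | n , ih with uniformLine hj (suc (suc m)) n k
... | o , uniform = o ℕ.+ n , extend
  where
  module _ (c : Word (suc (suc m)) (o ℕ.+ n) → Fin k) where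
    slice : Word (suc m) o → Word (suc (suc m)) n → Fin k
    slice u v = c (map suc u ++ v)
    u = proj₁ (uniform slice)
    u-active = proj₁ (proj₂ (uniform slice))
    u-uniform = proj₂ (proj₂ (uniform slice))
    -- The new block is frozen at one point of the line `u`; by `u-uniform` every other point gives
    -- the same colours.
    c′ : Word (suc (suc m)) n → Fin k
    c′ = slice (fill u zero)

    t = liftTemplate u
    t-active : nothing Vec.∈ t
    t-active = Vec.∈-map⁺ (Maybe.map suc) u-active

    -- At nonzero letters `t` stays in the smaller alphabet, where `u` is uniform; only its point at
    -- `zero` escapes control.
    reduce : ∀ a v → c (fill t (suc a) ++ v) ≡ c′ v
    reduce a v = trans (cong (λ w → c (w ++ v)) (fill-liftTemplate u a))
                       (u-uniform v a zero)

    fromSlice : MonochromaticLine c′ → MonochromaticLine c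
    fromSlice (s , s-active , mono) =
      map just w ++ s , Vec.∈-++⁺ʳ (map just w) s-active , λ a b →
        trans (cong c (eq a)) (trans (mono a b) (sym (cong c (eq b))))
      where
      w = map suc (fill u zero)
      eq : ∀ a → fill (map just w ++ s) a ≡ w ++ fill s a
      eq a = trans (fill-++ (map just w) s a) (cong (_++ fill s a) (fill-constant w a))

    module _ (f : Focused c′ r) where
      open Focused f

      -- The spoke has one colour off the letter `zero`, and at `zero` it passes through the focus.
      repeated : ∀ j → colour j ≡ c′ focus → MonochromaticLine c′
      repeated j eq = spoke j , active j , λ a b → trans (all a) (sym (all b))
        where
        all : ∀ a → c′ (fill (spoke j) a) ≡ colour j
        all zero    = trans (cong c′ (meets j)) (sym eq)
        all (suc a) = coloured j a

      add : ¬ (∃ λ j → colour j ≡ c′ focus) → Focused c (suc r)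
      add fresh = record
        { focus = fill t zero ++ focus
        ; spoke = λ j → t ++ tail j
        ; active = λ j → Vec.∈-++⁺ˡ t-active
        ; meets = λ { zero → trans (fill-++ t (tail zero) zero) (cong (fill t zero ++_) (fill-constant focus zero))
                    ; (suc j) → trans (fill-++ t (spoke j) zero) (cong (fill t zero ++_) (meets j)) }
        ; colour = colours
        ; coloured = λ j a → trans (cong c (fill-++ t (tail j) (suc a)))
            (trans (reduce a (fill (tail j) (suc a))) (tail-colour j a))
        ; injective = λ {i} {j} → inj i j
        }
        where
        tail : Fin (suc r) → Template (suc (suc m)) n
        -- The new spoke holds the old block at the old focus and moves in the new block alone.
        tail zero    = map just focus
        tail (suc j) = spoke j
        colours : Fin (suc r) → Fin k
        colours zero    = c′ focus
        colours (suc j) = colour j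
        tail-colour : ∀ j a → c′ (fill (tail j) (suc a)) ≡ colours j
        tail-colour zero    a = cong c′ (fill-constant focus (suc a))
        tail-colour (suc j) a = coloured j a
        inj : ∀ i j → colours i ≡ colours j → i ≡ j
        inj zero    zero    _  = refl
        inj zero    (suc j) eq = ⊥-elim (fresh (j , sym eq))
        inj (suc i) zero    eq = ⊥-elim (fresh (i , eq))
        inj (suc i) (suc j) eq = cong suc (injective eq)

    extend : MonochromaticLine c ⊎ Focused c (suc r)
    extend with ih c′
    ... | inj₁ line = inj₁ (fromSlice line)
    ... | inj₂ f with any? (λ j → Focused.colour f j ≟ c′ (Focused.focus f))
    ...   | yes (j , eq) = inj₁ (fromSlice (repeated f j eq))
    ...   | no fresh     = inj₂ (add f fresh)

-- Induction on the alphabet: `suc k` focused spokes would need `suc k` distinct colours out of `k`,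
-- so `focusing` must yield a line.
halesJewett : ∀ m → HalesJewett (suc m)
halesJewett zero k = 1 , λ c → nothing ∷ [] , Vec.here refl , λ { zero zero → refl }
halesJewett (suc m) k with focusing (halesJewett m) k (suc k)
... | n , dichotomy = n , line
  where
  line : (c : Word (suc (suc m)) n → Fin k) → MonochromaticLine c
  line c with dichotomy c
  ... | inj₁ l = l
  ... | inj₂ f = ⊥-elim (ℕ.1+n≰n (injective⇒≤ (Focused.injective f)))

-- A real whose integer translates avoid a sequence

-- Cantor's walk along the antidiagonals, each traversed with increasing first component.
next : ℕ × ℕ → ℕ × ℕ
next (a , zero)  = zero , suc a
next (a , suc b) = suc a , b

unpair : ℕ → ℕ × ℕ
unpair zero    = zero , zero
unpair (suc n) = next (unpair n)

unpair-surjective : ∀ p → ∃ λ n → unpair n ≡ p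
unpair-surjective (a , b) = onDiagonal (a ℕ.+ b) a b refl
  where
  onDiagonal : ∀ s a b → a ℕ.+ b ≡ s → ∃ λ n → unpair n ≡ (a , b)
  onDiagonal zero    zero    zero    _  = zero , refl
  -- The start of an antidiagonal is preceded by `(b , zero)`, the end of the previous one.
  onDiagonal (suc s) zero    (suc b) eq =
    let n , h = onDiagonal s b zero (trans (ℕ.+-identityʳ b) (ℕ.suc-injective eq))
    in suc n , cong next h
  onDiagonal s       (suc a) b       eq =
    let n , h = onDiagonal s a (suc b) (trans (ℕ.+-suc a b) eq)
    in suc n , cong next h

-- Integers are coded as differences of naturals, so two uses of `unpair` reach every pair, with
-- repetitions.
toℕ×ℤ : ℕ → ℕ × ℤ
toℕ×ℤ n = let m , k = unpair n ; p , q = unpair k in m , p ⊖ q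

toℕ×ℤ-surjective : ∀ m z → ∃ λ n → toℕ×ℤ n ≡ (m , z)
toℕ×ℤ-surjective m z =
  let (p , q) , pq = difference z
      k , hk = unpair-surjective (p , q)
      n , hn = unpair-surjective (m , k)
  in n , trans (cong (λ (m , k) → m , proj₁ (unpair k) ⊖ proj₂ (unpair k)) hn)
               (cong (m ,_) (trans (cong (λ (p , q) → p ⊖ q) hk) pq))
  where
  difference : ∀ z → ∃ λ ((p , q) : ℕ × ℕ) → p ⊖ q ≡ z
  difference (+ p)    = (p , 0) , refl
  difference -[1+ q ] = (0 , suc q) , refl

-- Integers inside the rationals, and rational estimates

ι : ℤ → ℚ
ι z = z ℚ./ 1

toℚᵘ-ι : ∀ z → ℚ.toℚᵘ (ι z) ℚᵘ.≃ mkℚᵘ z 0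
toℚᵘ-ι z = ℚ.toℚᵘ-fromℚᵘ (mkℚᵘ z 0)

ι-+ : ∀ a b → ι (a ℤ.+ b) ≡ ι a ℚ.+ ι b
ι-+ a b = ℚ.toℚᵘ-injective (begin
  ℚ.toℚᵘ (ι (a ℤ.+ b))                 ≈⟨ toℚᵘ-ι (a ℤ.+ b) ⟩
  mkℚᵘ (a ℤ.+ b) 0                     ≈⟨ *≡* (cong (ℤ._* + 1) (cong₂ ℤ._+_
    (sym (ℤ.*-identityʳ a)) (sym (ℤ.*-identityʳ b)))) ⟩
  mkℚᵘ a 0 ℚᵘ.+ mkℚᵘ b 0               ≈⟨ ℚᵘ.+-cong (toℚᵘ-ι a) (toℚᵘ-ι b) ⟨
  ℚ.toℚᵘ (ι a) ℚᵘ.+ ℚ.toℚᵘ (ι b)       ≈⟨ ℚ.toℚᵘ-homo-+ (ι a) (ι b) ⟨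
  ℚ.toℚᵘ (ι a ℚ.+ ι b)                 ∎)
  where open ℚᵘ.≃-Reasoning

ι-* : ∀ a b → ι (a ℤ.* b) ≡ ι a ℚ.* ι b
ι-* a b = ℚ.toℚᵘ-injective (begin
  ℚ.toℚᵘ (ι (a ℤ.* b))                 ≈⟨ toℚᵘ-ι (a ℤ.* b) ⟩
  mkℚᵘ a 0 ℚᵘ.* mkℚᵘ b 0               ≈⟨ ℚᵘ.*-cong (toℚᵘ-ι a) (toℚᵘ-ι b) ⟨
  ℚ.toℚᵘ (ι a) ℚᵘ.* ℚ.toℚᵘ (ι b)       ≈⟨ ℚ.toℚᵘ-homo-* (ι a) (ι b) ⟨
  ℚ.toℚᵘ (ι a ℚ.* ι b)                 ∎)
  where open ℚᵘ.≃-Reasoning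

ι-neg : ∀ a → ι (ℤ.- a) ≡ ℚ.- ι a
ι-neg a = ℚ.toℚᵘ-injective (begin
  ℚ.toℚᵘ (ι (ℤ.- a))                 ≈⟨ toℚᵘ-ι (ℤ.- a) ⟩
  ℚᵘ.- mkℚᵘ a 0                 ≈⟨ ℚᵘ.-‿cong (toℚᵘ-ι a) ⟨
  ℚᵘ.- ℚ.toℚᵘ (ι a)                 ≈⟨ ℚ.toℚᵘ-homo‿- (ι a) ⟨
  ℚ.toℚᵘ (ℚ.- ι a)                 ∎)
  where open ℚᵘ.≃-Reasoning

ι-pos : ∀ n → ℚ.Positive (ι (+ suc n))
ι-pos n = ℚ.normalize-pos (suc n) 1

-- A positive rational times its own denominator is its numerator, which is at least 1.
archimedean : ∀ ε → 0ℚ ℚ.< ε → ∃ λ n → 1ℚ ℚ.≤ ε ℚ.* ι (+ suc n)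
archimedean ε@record{denominator-1 = d} ε>0 = d , ℚ.toℚᵘ-cancel-≤ (begin
  ℚ.toℚᵘ 1ℚ                              ≤⟨ bound (ℚ.numerator ε) (ℤ.positive⁻¹ _ {{ℚ.positive ε>0}}) ⟩
  ℚ.toℚᵘ ε ℚᵘ.* mkℚᵘ (+ suc d) 0         ≃⟨ ℚᵘ.*-congˡ {ℚ.toℚᵘ ε} (toℚᵘ-ι (+ suc d)) ⟨
  ℚ.toℚᵘ ε ℚᵘ.* ℚ.toℚᵘ (ι (+ suc d))     ≃⟨ ℚ.toℚᵘ-homo-* ε (ι (+ suc d)) ⟨
  ℚ.toℚᵘ (ε ℚ.* ι (+ suc d))             ∎)
  where
  open ℚᵘ.≤-Reasoning
  bound : ∀ p → + 0 ℤ.< p → ℚ.toℚᵘ 1ℚ ℚᵘ.≤ mkℚᵘ p d ℚᵘ.* mkℚᵘ (+ suc d) 0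
  bound p p>0 = *≤* (ℤ.≤-trans (ℤ.≤-reflexive eq₁)
    (ℤ.≤-trans (ℤ.*-monoʳ-≤-nonNeg (+ suc d) (ℤ.i<j⇒suc[i]≤j p>0)) (ℤ.≤-reflexive eq₂)))
    where
    eq₁ : + 1 ℤ.* + (suc d ℕ.* 1) ≡ + 1 ℤ.* + suc d
    eq₁ = cong (λ n → + 1 ℤ.* + n) (ℕ.*-identityʳ (suc d))
    eq₂ : p ℤ.* + suc d ≡ p ℤ.* + suc d ℤ.* + 1
    eq₂ = sym (ℤ.*-identityʳ _)

p≤∣p∣ : ∀ p → p ℚ.≤ ∣ p ∣
p≤∣p∣ p with ℚ.≤-total 0ℚ p
... | inj₁ 0≤p = ℚ.≤-reflexive (sym (ℚ.0≤p⇒∣p∣≡p 0≤p))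
... | inj₂ p≤0 = ℚ.≤-trans p≤0 (ℚ.0≤∣p∣ p)

∣p-q∣≡∣q-p∣ : ∀ p q → ∣ p ℚ.- q ∣ ≡ ∣ q ℚ.- p ∣
∣p-q∣≡∣q-p∣ p q = trans (cong ∣_∣ (eq p q)) (ℚ.∣-p∣≡∣p∣ (q ℚ.- p))
  where
  open +-*-Solver
  eq : ∀ p q → p ℚ.- q ≡ ℚ.- (q ℚ.- p)
  eq = solve 2 (λ p q → p :- q := :- (q :- p)) refl

∣p-q∣<r⇒p<q+r : ∀ p q {r} → ∣ p ℚ.- q ∣ ℚ.< r → p ℚ.< q ℚ.+ r
∣p-q∣<r⇒p<q+r p q {r} h = begin-strict
  p               ≡⟨ eq p q ⟩
  q ℚ.+ (p ℚ.- q) <⟨ ℚ.+-monoʳ-< q (ℚ.≤-<-trans (p≤∣p∣ (p ℚ.- q)) h) ⟩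
  q ℚ.+ r         ∎
  where
  open ℚ.≤-Reasoning
  open +-*-Solver
  eq : ∀ p q → p ≡ q ℚ.+ (p ℚ.- q)
  eq = solve 2 (λ p q → p := q :+ (p :- q)) refl

p≤l+r∧l≤q⇒p-q≤r : ∀ {p q l r} → p ℚ.≤ l ℚ.+ r → l ℚ.≤ q → p ℚ.- q ℚ.≤ r
p≤l+r∧l≤q⇒p-q≤r {p} {q} {l} {r} p≤l+r l≤q = begin
  p ℚ.- q         ≤⟨ ℚ.+-mono-≤ p≤l+r (ℚ.neg-antimono-≤ l≤q) ⟩
  (l ℚ.+ r) ℚ.- l ≡⟨ solve 2 (λ l r → (l :+ r) :- l := r) refl l r ⟩
  r               ∎
  where
  open ℚ.≤-Reasoning
  open +-*-Solver

diameter : ∀ {p q l r} → l ℚ.≤ p → p ℚ.≤ l ℚ.+ r → l ℚ.≤ q → q ℚ.≤ l ℚ.+ r →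
  ∣ p ℚ.- q ∣ ℚ.≤ r
diameter {p} {q} l≤p p≤l+r l≤q q≤l+r with ℚ.≤-total 0ℚ (p ℚ.- q)
... | inj₁ 0≤p-q = subst (ℚ._≤ _) (sym (ℚ.0≤p⇒∣p∣≡p 0≤p-q)) (p≤l+r∧l≤q⇒p-q≤r p≤l+r l≤q)
... | inj₂ p-q≤0 = subst (ℚ._≤ _) (sym eq) (p≤l+r∧l≤q⇒p-q≤r q≤l+r l≤p)
  where
  open +-*-Solver
  neg : ℚ.- (p ℚ.- q) ≡ q ℚ.- p
  neg = solve 2 (λ p q → :- (p :- q) := q :- p) refl p q
  eq : ∣ p ℚ.- q ∣ ≡ q ℚ.- p
  eq = trans (∣p-q∣≡∣q-p∣ p q) (ℚ.0≤p⇒∣p∣≡p (subst (0ℚ ℚ.≤_) neg (ℚ.neg-antimono-≤ p-q≤0)))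

p≤p+q : ∀ {p q} → 0ℚ ℚ.≤ q → p ℚ.≤ p ℚ.+ q
p≤p+q {p} {q} 0≤q = ℚ.≤-trans (ℚ.≤-reflexive (sym (ℚ.+-identityʳ p))) (ℚ.+-monoʳ-≤ p 0≤q)

triangle-½ : ∀ p q r {ε} → ∣ p ℚ.- q ∣ ℚ.< ε ℚ.* ½ → ∣ q ℚ.- r ∣ ℚ.< ε ℚ.* ½ → ∣ p ℚ.- r ∣ ℚ.< ε
triangle-½ p q r {ε} h h′ = begin-strict
  ∣ p ℚ.- r ∣                     ≡⟨ cong ∣_∣ (solve 3 (λ p q r → p :- r := (p :- q) :+ (q :- r)) refl p q r) ⟩
  ∣ (p ℚ.- q) ℚ.+ (q ℚ.- r) ∣     ≤⟨ ℚ.∣p+q∣≤∣p∣+∣q∣ (p ℚ.- q) (q ℚ.- r) ⟩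
  ∣ p ℚ.- q ∣ ℚ.+ ∣ q ℚ.- r ∣     <⟨ ℚ.+-mono-< h h′ ⟩
  ε ℚ.* ½ ℚ.+ ε ℚ.* ½             ≡⟨ solve 1 (λ e → e :* con ½ :+ e :* con ½ := e) refl ε ⟩
  ε                               ∎
  where
  open ℚ.≤-Reasoning
  open +-*-Solver

-- The powers of 1/4: each stage of the diagonal construction keeps the first or the last quarter of
-- an interval. The two middle quarters separate them enough for one to be far from a given
-- rational.
width : ℕ → ℚ
width zero    = 1ℚ
width (suc n) = width n ℚ.* (½ ℚ.* ½)

width-pos : ∀ n → ℚ.Positive (width n)
width-pos zero    = _
width-pos (suc n) = ℚ.pos*pos⇒pos (width n) {{width-pos n}} (½ ℚ.* ½)

width>0 : ∀ n → 0ℚ ℚ.< width n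
width>0 n = ℚ.positive⁻¹ (width n) {{width-pos n}}

4× : ℚ → ℚ
4× p = (p ℚ.+ p) ℚ.+ (p ℚ.+ p)

width-suc : ∀ n → width n ≡ 4× (width (suc n))
width-suc n = solve 1 (λ w → w := (w :* c :+ w :* c) :+ (w :* c :+ w :* c)) refl (width n)
  where
  open +-*-Solver
  c : ∀ {n} → Polynomial n
  c = con (½ ℚ.* ½)

-- A crude Bernoulli inequality: passing to `suc n` divides the width by 4, and n + 2 ≤ 4(n + 1).
width-bound : ∀ n → ι (+ n) ℚ.* width n ℚ.+ width n ℚ.≤ 1ℚ
width-bound zero    = ℚ.≤-reflexive refl
width-bound (suc n) = begin
  ι (+ suc n) ℚ.* w ℚ.+ w          ≡⟨ cong (λ s → s ℚ.* w ℚ.+ w) (ι-+ (+ 1) (+ n)) ⟩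
  (1ℚ ℚ.+ i) ℚ.* w ℚ.+ w           ≤⟨ p≤p+q (ℚ.+-mono-≤ (ℚ.+-mono-≤ 0≤iw (ℚ.+-mono-≤ 0≤iw 0≤iw)) (ℚ.+-mono-≤ 0≤w 0≤w)) ⟩
  (1ℚ ℚ.+ i) ℚ.* w ℚ.+ w ℚ.+ (iw ℚ.+ (iw ℚ.+ iw) ℚ.+ (w ℚ.+ w)) ≡⟨ eq i w ⟩
  i ℚ.* 4× w ℚ.+ 4× w              ≡⟨ cong (λ v → i ℚ.* v ℚ.+ v) (width-suc n) ⟨
  i ℚ.* width n ℚ.+ width n        ≤⟨ width-bound n ⟩
  1ℚ                               ∎
  where
  open ℚ.≤-Reasoning
  open +-*-Solver
  i = ι (+ n)
  w = width (suc n)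
  iw = i ℚ.* w
  0≤w : 0ℚ ℚ.≤ w
  0≤w = ℚ.<⇒≤ (width>0 (suc n))
  instance
    i-nonNeg : ℚ.NonNegative i
    i-nonNeg = ℚ.normalize-nonNeg n 1
  0≤iw : 0ℚ ℚ.≤ iw
  0≤iw = ℚ.≤-trans (ℚ.≤-reflexive (sym (ℚ.*-zeroʳ i))) (ℚ.*-monoˡ-≤-nonNeg i 0≤w)
  eq : ∀ i w → (1ℚ ℚ.+ i) ℚ.* w ℚ.+ w ℚ.+ (i ℚ.* w ℚ.+ (i ℚ.* w ℚ.+ i ℚ.* w) ℚ.+ (w ℚ.+ w)) ≡ i ℚ.* 4× w ℚ.+ 4× w
  eq = solve 2 (λ i w → let 4w = (w :+ w) :+ (w :+ w) in
    (con 1ℚ :+ i) :* w :+ w :+ (i :* w :+ (i :* w :+ i :* w) :+ (w :+ w)) := i :* 4w :+ 4w) refl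

width-small : ∀ ε → 0ℚ ℚ.< ε → ∃ λ n → width n ℚ.< ε
width-small ε ε>0 with archimedean ε ε>0
... | n , 1≤ε*d = suc n , ℚ.*-cancelʳ-<-nonNeg d {{ℚ.pos⇒nonNeg d {{ι-pos n}}}} (begin-strict
  w ℚ.* d           ≡⟨ ℚ.*-comm w d ⟩
  d ℚ.* w           ≡⟨ ℚ.+-identityʳ (d ℚ.* w) ⟨
  -- The extra summand in `width-bound` is what makes the comparison strict.
  d ℚ.* w ℚ.+ 0ℚ    <⟨ ℚ.+-monoʳ-< (d ℚ.* w) (width>0 (suc n)) ⟩
  d ℚ.* w ℚ.+ w     ≤⟨ width-bound (suc n) ⟩
  1ℚ                ≤⟨ 1≤ε*d ⟩
  ε ℚ.* d           ∎)
  where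
  open ℚ.≤-Reasoning
  w = width (suc n)
  d = ι (+ suc n)

-- q cannot be w-close to both the first and the last quarter of [l , l + 4w].
avoid : ∀ l w q → 0ℚ ℚ.< w → ∃ λ l′ → l ℚ.≤ l′ × l′ ℚ.+ w ℚ.≤ l ℚ.+ 4× w ×
  (∀ p → l′ ℚ.≤ p → p ℚ.≤ l′ ℚ.+ w → ¬ ∣ p ℚ.- q ∣ ℚ.< w)
avoid l w q w>0 with l ℚ.+ (w ℚ.+ w) ℚ.≤? q
... | yes l+2w≤q = l , ℚ.≤-refl , fits , λ p _ p≤l+w ∣p-q∣<w →
  ℚ.<-irrefl refl (begin-strict
    q                   <⟨ ∣p-q∣<r⇒p<q+r q p (subst (ℚ._< w) (∣p-q∣≡∣q-p∣ p q) ∣p-q∣<w) ⟩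
    p ℚ.+ w             ≤⟨ ℚ.+-monoˡ-≤ w p≤l+w ⟩
    (l ℚ.+ w) ℚ.+ w     ≡⟨ ℚ.+-assoc l w w ⟩
    l ℚ.+ (w ℚ.+ w)     ≤⟨ l+2w≤q ⟩
    q                   ∎)
  where
  open ℚ.≤-Reasoning
  fits : l ℚ.+ w ℚ.≤ l ℚ.+ 4× w
  fits = ℚ.+-monoʳ-≤ l (ℚ.≤-trans (p≤p+q (ℚ.<⇒≤ w>0)) (p≤p+q (ℚ.<⇒≤ (ℚ.+-mono-< w>0 w>0))))
... | no l+2w≰q = l ℚ.+ (w ℚ.+ w ℚ.+ w) , p≤p+q (ℚ.<⇒≤ (ℚ.+-mono-< (ℚ.+-mono-< w>0 w>0) w>0)) ,
  ℚ.≤-reflexive (solve 2 (λ l w → l :+ (w :+ w :+ w) :+ w := l :+ ((w :+ w) :+ (w :+ w))) refl l w) ,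
  λ p l′≤p _ ∣p-q∣<w → ℚ.<-irrefl refl (begin-strict
    l ℚ.+ (w ℚ.+ w ℚ.+ w)   ≤⟨ l′≤p ⟩
    p                       <⟨ ∣p-q∣<r⇒p<q+r p q ∣p-q∣<w ⟩
    q ℚ.+ w                 <⟨ ℚ.+-monoˡ-< w (ℚ.≰⇒> l+2w≰q) ⟩
    l ℚ.+ (w ℚ.+ w) ℚ.+ w   ≡⟨ ℚ.+-assoc l (w ℚ.+ w) w ⟩
    l ℚ.+ (w ℚ.+ w ℚ.+ w)   ∎)
  where
  open ℚ.≤-Reasoning
  open +-*-Solver

½-pos : ∀ {ε} → 0ℚ ℚ.< ε → 0ℚ ℚ.< ε ℚ.* ½
½-pos {ε} ε>0 = ℚ.positive⁻¹ (ε ℚ.* ½) {{ℚ.pos*pos⇒pos ε {{ℚ.positive ε>0}} ½}}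

module Diagonal (a : ℕ → ℝ) where

  -- Half the next width is allowed for approximating `a n`; the other half is for the supposed
  -- closeness of `limit` to `a n`.
  modulus : ℕ → ℕ
  modulus n = proj₁ (cauchy (a n) (width (suc n) ℚ.* ½) (½-pos (width>0 (suc n))))

  -- The case split in `avoid` needs a decidable order, hence a rational in place of the real `a n`.
  approximation : ℕ → ℚ
  approximation n = seq (a n) (modulus n)

  lower : ℕ → ℚ
  next-lower : ∀ n → _
  lower zero    = 0ℚ
  lower (suc n) = proj₁ (next-lower n)
  next-lower n = avoid (lower n) (width (suc n)) (approximation n) (width>0 (suc n))

  upper : ℕ → ℚ
  upper n = lower n ℚ.+ width n

  -- `≤′` grows at its right end, one stage of the construction at a time.
  nested : ∀ {m n} → m ℕ.≤′ n → lower m ℚ.≤ lower n × upper n ℚ.≤ upper m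
  nested ℕ.≤′-refl = ℚ.≤-refl , ℚ.≤-refl
  nested {m} {suc n} (ℕ.≤′-step m≤n) =
    let _ , low , up , _ = next-lower n
        l , u = nested m≤n
    in ℚ.≤-trans l low ,
       ℚ.≤-trans up (subst (λ w → lower n ℚ.+ w ℚ.≤ upper m) (width-suc n) u)

  between : ∀ {m n} → m ℕ.≤ n → lower m ℚ.≤ lower n × lower n ℚ.≤ upper m
  between {m} {n} m≤n =
    let l , u = nested (ℕ.≤⇒≤′ m≤n)
    in l , ℚ.≤-trans (p≤p+q (ℚ.<⇒≤ (width>0 n))) u

  -- From stage `N` on, the left endpoints stay in the `N`-th interval, so its width bounds their
  -- differences.
  limit : ℝ
  limit = mkℝ lower λ ε ε>0 →
    let N , small = width-small ε ε>0 in
    N , λ m n N≤m N≤n →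
      let lm , um = between N≤m
          ln , un = between N≤n
      in ℚ.≤-<-trans (diameter {lower m} {lower n} lm um ln un) small

  limit≉ : ∀ n → ¬ limit ≈ a n
  limit≉ n limit≈an =
    let w½ = width (suc n) ℚ.* ½
        w½>0 = ½-pos (width>0 (suc n))
        M , near = close limit≈an w½ w½>0
        K , tail = cauchy (a n) w½ w½>0
        -- Late enough for `near` and `tail` to apply, and for `lower i` to lie in the interval
        -- chosen to avoid `approximation n`.
        i = M ℕ.⊔ K ℕ.⊔ suc n
        MK≤i = ℕ.m≤m⊔n (M ℕ.⊔ K) (suc n)
        l , u = between (ℕ.m≤n⊔m (M ℕ.⊔ K) (suc n))
        _ , _ , _ , avoids = next-lower n
    in avoids (lower i) l u
         (triangle-½ (lower i) (seq (a n) i) (approximation n)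
           (near i (ℕ.m⊔n≤o⇒m≤o M K MK≤i))
           (tail i K (ℕ.m⊔n≤o⇒n≤o M K MK≤i) ℕ.≤-refl))

≈-pointwise : ∀ {x y} → (∀ n → seq x n ≡ seq y n) → x ≈ y
≈-pointwise {x} {y} eq .close ε ε>0 = 0 , λ n _ → subst (ℚ._< ε)
  (sym (cong ∣_∣ (trans (cong (ℚ._- seq y n) (eq n)) (ℚ.+-inverseʳ (seq y n))))) ε>0

-- With `z` moved across, the forbidden values `a n` - `z` form one sequence, to which the diagonal
-- construction applies.
avoidingTranslates : (a : ℕ → ℝ) → ∃ λ x → ∀ n z → ¬ x + fromℤ z ≈ a n
avoidingTranslates a = limit , fromTranslates {limit} limit≉
  where
  translate : ℕ × ℤ → ℝ
  translate (n , z) = a n + fromℤ (ℤ.- z)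
  open Diagonal (λ i → translate (toℕ×ℤ i))

  shift : ∀ x z y → x + fromℤ z ≈ y → x ≈ y + fromℤ (ℤ.- z)
  shift x z y x+z≈y .close ε ε>0 =
    let N , h = close x+z≈y ε ε>0 in
    N , λ n N≤n → subst (λ p → ∣ p ∣ ℚ.< ε) (eq (seq x n) (seq y n)) (h n N≤n)
    where
    open +-*-Solver
    eq : ∀ p q → (p ℚ.+ ι z) ℚ.- q ≡ p ℚ.- (q ℚ.+ ι (ℤ.- z))
    eq p q = trans (solve 3 (λ p q z → (p :+ z) :- q := p :- (q :+ (:- z))) refl p q (ι z))
                   (cong (λ t → p ℚ.- (q ℚ.+ t)) (sym (ι-neg z)))

  avoidsPair : ∀ x n z {p} → p ≡ (n , z) → ¬ x ≈ translate p → ¬ x + fromℤ z ≈ a n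
  avoidsPair x n z refl x≉ x+z≈an = x≉ (shift x z (a n) x+z≈an)

  fromTranslates : ∀ {x} → (∀ i → ¬ x ≈ translate (toℕ×ℤ i)) → ∀ n z → ¬ x + fromℤ z ≈ a n
  fromTranslates {x} x≉ n z =
    let i , eq = toℕ×ℤ-surjective n z in avoidsPair x n z eq (x≉ i)

-- From combinatorial lines to homothetic copies

weight : ∀ {m n} → (Fin m → ℤ) → Word m n → ℤ
weight f []      = + 0
weight f (a ∷ w) = f a ℤ.+ weight f w

fixedWeight : ∀ {m n} → (Fin m → ℤ) → Template m n → ℤ
fixedWeight f []            = + 0
fixedWeight f (nothing ∷ t) = fixedWeight f t
fixedWeight f (just a ∷ t)  = f a ℤ.+ fixedWeight f t

dimension : ∀ {m n} → Template m n → ℕ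
dimension []            = 0
dimension (nothing ∷ t) = suc (dimension t)
dimension (just _ ∷ t)  = dimension t

dimension-pos : ∀ {m n} {t : Template m n} → nothing Vec.∈ t → ∃ λ d → dimension t ≡ suc d
dimension-pos {t = nothing ∷ t} _               = dimension t , refl
dimension-pos {t = just _ ∷ t}  (Vec.there i)   = dimension-pos i

-- Each active coordinate contributes one `f a` and the fixed ones ignore `a`; summing thus turns a
-- combinatorial line into a scaled translate of the values of `f`.
weight-fill : ∀ {m n} (f : Fin m → ℤ) (t : Template m n) a →
  weight f (fill t a) ≡ fixedWeight f t ℤ.+ + dimension t ℤ.* f a
weight-fill f []            a = refl
weight-fill f (just b ∷ t)  a = trans (cong (λ z → f b ℤ.+ z) (weight-fill f t a))
  (sym (ℤ.+-assoc (f b) (fixedWeight f t) (+ dimension t ℤ.* f a)))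
weight-fill f (nothing ∷ t) a = trans (cong (λ z → f a ℤ.+ z) (weight-fill f t a))
  (solve 3 (λ x b d → x :+ (b :+ d :* x) := b :+ (con (+ 1) :+ d) :* x) refl
    (f a) (fixedWeight f t) (+ dimension t))
  where open ℤ.+-*-Solver

constant : ℚ → ℝ
constant q = mkℝ (λ _ → q) λ ε ε>0 →
  0 , λ _ _ _ _ → subst (ℚ._< ε) (cong ∣_∣ (sym (ℚ.+-inverseʳ q))) ε>0

recipSuc : ℕ → ℚ
recipSuc d = (ℚ.1/ ι (+ suc d)) {{ℚ.pos⇒nonZero (ι (+ suc d)) {{ι-pos d}}}}

recipSuc-pos : ∀ d → ℚ.Positive (recipSuc d)
recipSuc-pos d = ℚ.1/pos⇒pos (ι (+ suc d)) {{ι-pos d}}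

recipSuc-inverse : ∀ d → recipSuc d ℚ.* ι (+ suc d) ≡ 1ℚ
recipSuc-inverse d = ℚ.*-inverseˡ (ι (+ suc d)) {{ℚ.pos⇒nonZero (ι (+ suc d)) {{ι-pos d}}}}

constant-positive : ∀ q → ℚ.Positive q → Positive (constant q)
constant-positive q q>0 =
  let p , 0<p , p<q = ℚ.<-dense (ℚ.positive⁻¹ q {{q>0}})
  in p , 0<p , 0 , λ _ _ → p<q

affine-cong : ∀ v d {x y} → x ≈ y → v + constant (recipSuc d) * x ≈ v + constant (recipSuc d) * y
affine-cong v d {x} {y} x≈y .close ε ε>0 =
  -- `D` is the inverse of the factor `r`, so the tolerance comes out as `ε`.
  let N , h = close x≈y (D ℚ.* ε) (ℚ.positive⁻¹ _ {{ℚ.pos*pos⇒pos D {{ι-pos d}} ε {{ℚ.positive ε>0}}}})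
  in N , λ n N≤n → begin-strict
    ∣ (seq v n ℚ.+ r ℚ.* seq x n) ℚ.- (seq v n ℚ.+ r ℚ.* seq y n) ∣
      ≡⟨ cong ∣_∣ (solve 4 (λ v r x y → (v :+ r :* x) :- (v :+ r :* y) := r :* (x :- y)) refl
           (seq v n) r (seq x n) (seq y n)) ⟩
    ∣ r ℚ.* (seq x n ℚ.- seq y n) ∣     ≡⟨ ℚ.∣p*q∣≡∣p∣*∣q∣ r _ ⟩
    ∣ r ∣ ℚ.* ∣ seq x n ℚ.- seq y n ∣   ≡⟨ cong (ℚ._* _) (ℚ.0≤p⇒∣p∣≡p (ℚ.<⇒≤ (ℚ.positive⁻¹ r {{recipSuc-pos d}}))) ⟩
    r ℚ.* ∣ seq x n ℚ.- seq y n ∣       <⟨ ℚ.*-monoʳ-<-pos r {{recipSuc-pos d}} (h n N≤n) ⟩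
    r ℚ.* (D ℚ.* ε)                     ≡⟨ ℚ.*-assoc r D ε ⟨
    r ℚ.* D ℚ.* ε                       ≡⟨ cong (ℚ._* ε) (recipSuc-inverse d) ⟩
    1ℚ ℚ.* ε                            ≡⟨ ℚ.*-identityˡ ε ⟩
    ε                                   ∎
  where
  open ℚ.≤-Reasoning
  open +-*-Solver
  r = recipSuc d
  D = ι (+ suc d)

-- `Homothetic` maps the copy onto `S`, so s ↦ x + b + (d + 1)s has to be inverted; -(x + b)/(d + 1)
-- is the constant term of the inverse.
translation : ℝ → ℤ → ℕ → ℝ
translation x b d = constant (ℚ.- 1ℚ) * (constant (recipSuc d) * (x + fromℤ b))

rescaling : ∀ x b d s →
  fromℤ s ≈ translation x b d + constant (recipSuc d) * (x + fromℤ (b ℤ.+ + suc d ℤ.* s))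
rescaling x b d s = ≈-pointwise λ n → sym (begin
  ℚ.- 1ℚ ℚ.* (r ℚ.* (seq x n ℚ.+ ι b)) ℚ.+ r ℚ.* (seq x n ℚ.+ ι (b ℤ.+ + suc d ℤ.* s))
    ≡⟨ cong (λ t → ℚ.- 1ℚ ℚ.* (r ℚ.* (seq x n ℚ.+ ι b)) ℚ.+ r ℚ.* (seq x n ℚ.+ t))
         (trans (ι-+ b (+ suc d ℤ.* s)) (cong (ι b ℚ.+_) (ι-* (+ suc d) s))) ⟩
  ℚ.- 1ℚ ℚ.* (r ℚ.* (seq x n ℚ.+ ι b)) ℚ.+ r ℚ.* (seq x n ℚ.+ (ι b ℚ.+ ι (+ suc d) ℚ.* ι s))
    ≡⟨ solve 5 (λ r x b d s → con (ℚ.- 1ℚ) :* (r :* (x :+ b)) :+ r :* (x :+ (b :+ d :* s)) := r :* d :* s)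
         refl r (seq x n) (ι b) (ι (+ suc d)) (ι s) ⟩
  r ℚ.* ι (+ suc d) ℚ.* ι s
    ≡⟨ cong (ℚ._* ι s) (recipSuc-inverse d) ⟩
  1ℚ ℚ.* ι s
    ≡⟨ ℚ.*-identityˡ (ι s) ⟩
  ι s ∎)
  where
  open ≡-Reasoning
  open +-*-Solver
  r = recipSuc d

-- In use `e` is the dimension of a line and `w` the weight of a word on it; kept as variables, they
-- are eliminated by matching on `refl`.
rescale : ∀ x b d s w {e} → e ≡ suc d → w ≡ b ℤ.+ + e ℤ.* s → ∀ p →
  p ≈ fromℤ s → p ≈ translation x b d + constant (recipSuc d) * (x + fromℤ w)
rescale x b d s _ refl refl p p≈ = ≈-trans {p} {fromℤ s} p≈ (rescaling x b d s)

unscale : ∀ x b d s w {e} → e ≡ suc d → w ≡ b ℤ.+ + e ℤ.* s → ∀ a p →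
  a ≈ x + fromℤ w → p ≈ translation x b d + constant (recipSuc d) * a → p ≈ fromℤ s
unscale x b d s w refl refl a p a≈ p≈ =
  ≈-trans {p} p≈
    (≈-trans (affine-cong (translation x b d) d {a} {x + fromℤ w} a≈)
      (≈-sym (rescaling x b d s)))

-- Monochromatic copies inside a translated integer grid

gridPoint : 𝔼² → ℤ × ℤ → 𝔼²
gridPoint (x , y) (i , j) = x + fromℤ i , y + fromℤ j

module _ (o : 𝔼²) {m} (s : Fin m → ℤ × ℤ) where

  wordPoint : ∀ {n} → Word m n → 𝔼²
  wordPoint w = gridPoint o (weight (proj₁ ∘ s) w , weight (proj₂ ∘ s) w)

  module _ {n} (t : Template m n) where

    lineImage : Subset
    lineImage = image (λ i → wordPoint (fill t i)) U

    lineImage-monochromatic : ∀ {k} (χ : Coloring k) →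
      (∀ i j → Func.to χ (wordPoint (fill t i)) ≡ Func.to χ (wordPoint (fill t j))) →
      Monochromatic χ lineImage
    lineImage-monochromatic χ mono p q (i , _ , p≈) (j , _ , q≈) =
      trans (Func.cong χ p≈) (trans (mono i j) (sym (Func.cong χ q≈)))

    lineImage-homothetic : ∀ {d} → dimension t ≡ suc d → {S : Pred (ℤ × ℤ) 0ℓ} →
      (∀ i → S (s i)) → (∀ {z} → S z → ∃ λ i → z ≡ s i) → Homothetic lineImage (lattice S)
    lineImage-homothetic {d} dim {S} s∈S onto =
      v , r , constant-positive (recipSuc d) (recipSuc-pos d) ,
      (λ {p} → forward p) , (λ {p} → backward p)
      where
      r : ℝ
      r = constant (recipSuc d)
      v : 𝔼²
      v = translation (proj₁ o) (fixedWeight (proj₁ ∘ s) t) d ,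
          translation (proj₂ o) (fixedWeight (proj₂ ∘ s) t) d

      -- `mk≈ (close h)` retypes h along a conversion of sequences; converting the
      -- reals themselves would also compare their Cauchy proofs, which blows up.
      forward : ∀ p → p ∈ lattice S → p ∈ image (λ a → v +ᵥ r · a) (points lineImage)
      forward p (z , z∈S , p≈) =
        let i , z≡ = onto z∈S in
        wordPoint (fill t i) , (i , tt , ≈-pointwise (λ _ → refl) , ≈-pointwise (λ _ → refl)) ,
        reach i z≡ p≈
        where
        reach : ∀ i {z} → z ≡ s i → p 𝔼².≈ (fromℤ (proj₁ z) , fromℤ (proj₂ z)) →
          p 𝔼².≈ v +ᵥ r · wordPoint (fill t i)
        reach i refl (p₁≈ , p₂≈) =
          mk≈ (close (rescale (proj₁ o) (fixedWeight (proj₁ ∘ s) t) d (proj₁ (s i)) (weight (proj₁ ∘ s) (fill t i))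
            dim (weight-fill (proj₁ ∘ s) t i) (proj₁ p) p₁≈)) ,
          mk≈ (close (rescale (proj₂ o) (fixedWeight (proj₂ ∘ s) t) d (proj₂ (s i)) (weight (proj₂ ∘ s) (fill t i))
            dim (weight-fill (proj₂ ∘ s) t i) (proj₂ p) p₂≈))

      backward : ∀ p → p ∈ image (λ a → v +ᵥ r · a) (points lineImage) → p ∈ lattice S
      backward p (a , (i , _ , a₁≈ , a₂≈) , p₁≈ , p₂≈) = s i , s∈S i ,
        unscale (proj₁ o) (fixedWeight (proj₁ ∘ s) t) d
          (proj₁ (s i)) (weight (proj₁ ∘ s) (fill t i)) dim (weight-fill (proj₁ ∘ s) t i)
          (proj₁ a) (proj₁ p) (mk≈ (close a₁≈)) (mk≈ (close p₁≈)) ,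
        unscale (proj₂ o) (fixedWeight (proj₂ ∘ s) t) d
          (proj₂ (s i)) (weight (proj₂ ∘ s) (fill t i)) dim (weight-fill (proj₂ ∘ s) t i)
          (proj₂ a) (proj₂ p) (mk≈ (close a₂≈)) (mk≈ (close p₂≈))

-- The last component confines the copy to the grid through `o`, which lets the choice of `o` steer
-- it away from an enumeration.
HomotheticCopy : ∀ {k} → Coloring k → 𝔼² → Pred (ℤ × ℤ) 0ℓ → Set₁
HomotheticCopy χ o S = ∃ λ A → (Monochromatic χ A × Homothetic A (lattice S)) ×
  (∀ p → p ∈ A → ∃ λ z → p 𝔼².≈ gridPoint o z)

-- The letters are indices into a listing of `S`, possibly with repetitions; `fill` runs through
-- them to trace the copy.
gallaiIndexed : ∀ {m} (s : Fin (suc m) → ℤ × ℤ) {S : Pred (ℤ × ℤ) 0ℓ} →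
  (∀ i → S (s i)) → (∀ {z} → S z → ∃ λ i → z ≡ s i) →
  ∀ {k} (χ : Coloring k) o → HomotheticCopy χ o S
gallaiIndexed {m} s {S} s∈S onto {k} χ o =
  let _ , monochromaticLine = halesJewett m k
      t , active , mono = monochromaticLine (λ w → Func.to χ (wordPoint o s w))
      _ , dim = dimension-pos active
  in fromLine t dim mono
  where
  fromLine : ∀ {n} (t : Template (suc m) n) {d} → dimension t ≡ suc d →
    (∀ i j → Func.to χ (wordPoint o s (fill t i)) ≡ Func.to χ (wordPoint o s (fill t j))) →
    HomotheticCopy χ o S
  fromLine t dim mono =
    lineImage o s t ,
    (lineImage-monochromatic o s t χ mono , lineImage-homothetic o s t dim s∈S onto) ,
    λ p (i , _ , p₁≈ , p₂≈) →
      (weight (proj₁ ∘ s) (fill t i) , weight (proj₂ ∘ s) (fill t i)) , mk≈ (close p₁≈) , mk≈ (close p₂≈)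

gallai : ∀ {S : Pred (ℤ × ℤ) 0ℓ} → Finite S → Satisfiable S →
  ∀ {k} (χ : Coloring k) o → HomotheticCopy χ o S
gallai (List.[] , S⊆xs , _) (_ , z∈S) _ _ = ⊥-elim (¬Any[] (S⊆xs z∈S))
gallai (xs@(_ List.∷ _) , S⊆xs , xs⊆S) _ χ o =
  gallaiIndexed (List.lookup xs) (λ i → xs⊆S (∈-lookup i))
    (λ z∈S → index (S⊆xs z∈S) , lookup-index (S⊆xs z∈S)) χ o

-- Uncountability by diagonalisation

theorem9 : (S : Pred (ℤ × ℤ) 0ℓ) → Finite S → Satisfiable S →
    (k : ℕ) → .{{_ : NonZero k}} → (χ : Coloring k) →
    UncountablyMany (λ A → Monochromatic χ A × Homothetic A (lattice S))
theorem9 S finite nonempty@(s₀ , s₀∈S) k χ enumeration =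
  absurd (avoidingTranslates (λ n → abscissa (to n)))
  where
  open Surjection enumeration using (to; strictlySurjective)
  𝒞 : Pred Subset 0ℓ
  𝒞 A = Monochromatic χ A × Homothetic A (lattice S)

  -- The homothety carries `B` onto `S`, so `s₀` has a preimage in `B`.
  representative : ∀ B → 𝒞 B → ∃ (_∈ B)
  representative _ (_ , _ , _ , _ , S⊆ , _) =
    let b , b∈B , _ = S⊆ (s₀ , s₀∈S , 𝔼².refl) in b , b∈B

  abscissa : Maybe (∃ 𝒞) → ℝ
  abscissa (just (B , B∈𝒞)) = proj₁ (proj₁ (representative B B∈𝒞))
  -- `nothing` names no set; the value is an arbitrary default.
  abscissa nothing          = fromℤ (+ 0)

  module _ {x : ℝ} {A : Subset} (A∈𝒞 : 𝒞 A)
           (onGrid : ∀ p → p ∈ A → ∃ λ z → p 𝔼².≈ gridPoint (x , fromℤ (+ 0)) z) where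
    -- The enumeration returns `A` only up to equality of subsets, so the representative is that of
    -- the listed set `B`; it lies in `A`, hence on the grid, and its abscissa is an integer
    -- translate of `x`.
    missed : ∀ B → Maybe.Pointwise (λ B C → proj₁ B ≈ₛ proj₁ C) B (just (A , A∈𝒞)) →
      ¬ (∀ z → ¬ x + fromℤ z ≈ abscissa B)
    missed (just (B , B∈𝒞)) (Maybe.just (B⊆A , _)) avoids =
      let b , b∈B = representative B B∈𝒞
          (i , _) , b≈ = onGrid b (B⊆A b∈B)
      in avoids i (≈-sym (proj₁ b≈))

  absurd : ¬ (∃ λ x → ∀ n z → ¬ x + fromℤ z ≈ abscissa (to n))
  absurd (x , avoids) =
    let A , A∈𝒞 , onGrid = gallai finite nonempty χ (x , fromℤ (+ 0))
        n , h = strictlySurjective (just (A , A∈𝒞))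
    in missed {x} A∈𝒞 onGrid (to n) h (avoids n)
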